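{- Let $\lambda_0,\lambda_2,\lambda_3$ be computons in a computon category and let $\rho$ be a span $\lambda_2\xleftarrow{\lambda_2^+}\lambda_0\xrightarrow{\lambda_3^+}\lambda_3$ of in-markers with $\lambda_0\cong\lambda_2$. Then $\lambda_2?_{\rho}\lambda_3\cong\lambda_2+_{\lambda_0}\lambda_3\cong\lambda_3$, where $\lambda_2?_\rho\lambda_3$ is the open branching computon of $\rho$.
   Context: Fix $n\ge 1$, the set of types $\underline{n}:=\{0,1,\dots,n-1\}$ (type $0$ is the control type), and a finite nonempty set $B\subset\Sigma^*$ of computing devices over a finite alphabet $\Sigma$, with a distinguished element $\epsilon\in B$. All computons are over these fixed $\underline{n}$ and $B$. **Computon.** A computon $\lambda$ is a tuple $(U,P,I,O,\underline{n},B,\sigma,t,\tau,s,c,r,f)$ where $U$ (computation units), $I$ (inflows), $O$ (outflows) are finite sets, $P$ (ports) is a finite nonempty set, $\sigma\colon O\to U$, $\tau\colon I\to U$ and $r\colon I\to O$ are surjective functions, and $t\colon O\to P$, $s\colon I\to P$, $c\colon P\to\underline{n}$, $f\colon O\to B$ are functions, such that: the restrictions of $\tau$ to $(c\circ s)^{ -1}(0)$ and of $\sigma$ to $(c\circ t)^{ -1}(0)$ are surjective onto $U$; $\sigma\circ r=\tau$; and there exist $p\in P\setminus t(O)$ and $q\in P\setminus s(I)$ with $c(p)=0=c(q)$. Components of a computon $\lambda_k$ carry the index $k$. Write $P^+:=P\setminus t(O)$ (inports), $P^-:=P\setminus s(I)$ (outports), and for $p\in P$ write $p\bullet:=\tau(s^{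 -1}(p))$ and $\bullet p:=\sigma(t^{ -1}(p))$. **Morphism.** A computon morphism $\alpha\colon\lambda_1\to\lambda_2$ consists of functions $\alpha_U\colon U_1\to U_2$, $\alpha_P\colon P_1\to P_2$, $\alpha_I\colon I_1\to I_2$, $\alpha_O\colon O_1\to O_2$ and the inclusions (identities) on $\underline{n}$ and on $B$, such that $\alpha_U\tau_1=\tau_2\alpha_I$, $\alpha_U\sigma_1=\sigma_2\alpha_O$, $\alpha_P s_1=s_2\alpha_I$, $\alpha_P t_1=t_2\alpha_O$, $\alpha_O r_1=r_2\alpha_I$, $f_2\alpha_O=f_1$, $c_2\alpha_P=c_1$, and $\vec{i}(\alpha)\cup\vec{o}(\alpha)\subseteq P_1^+\cup P_1^-$, where $\vec{i}(\alpha)=\{p\in P_1\mid \bullet\alpha_P(p)\setminus\alpha_U(\bullet p)\ne\emptyset\}$ and $\vec{o}(\alpha)=\{p\in P_1\mid \alpha_P(p)\bullet\setminus\alpha_U(p\bullet)\neq\emptyset\}$. Morphisms compose componentwise; a monomorphism is a morphism all of whose components are injective; isomorphism $\cong$ means isomorphism in this category. **In-markers.** A computon is trivial if $U=I=O=\emptyset$. An in-marker of a computon $\lambda$, written $\lambda^+$, is a computon monomorphism $\lambda^+\colon\lambda_0\to\lambda$ where $\lambda_0$ is a trivial computon and $\lambda^+(P_0)=P^+$. **Pushout.** The pushout $\lambda_1+_{\lambda_0}\lambda_2$ of a span $\lambda_1\xleftarrow{\alpha_1}\lambda_0\xrightarrow{\alpha_2}\lambda_2$ is formed componentwise: its sets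 of units, ports, inflows and outflows are the pushouts of finite sets $U_1\sqcup_{U_0}U_2$, $P_1\sqcup_{P_0}P_2$, $I_1\sqcup_{I_0}I_2$, $O_1\sqcup_{O_0}O_2$, with the induced structure functions (over the same $\underline{n}$ and $B$). It is a known fact that the pushout of a span of markers exists in the category of computons. **Open branching.** The open branching computon $\lambda_2?_\rho\lambda_3$ is the pushout of a span $\rho:=(\lambda_2\xleftarrow{\lambda_2^+}\lambda_0\xrightarrow{\lambda_3^+}\lambda_3)$ of in-markers. -}

module Defs where

open import Data.Fin using (Fin; toℕ)
import Data.Fin.Properties as Fin
open import Data.List using (List)
import Data.List.Membership.Propositional as List
open import Data.Nat using (ℕ; NonZero)
open import Data.Product using (∃; Σ-syntax; ∃-syntax; _×_; _,_; proj₁; proj₂)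
open import Data.Sum using (_⊎_; inj₁; inj₂)
open import Function.Base using (id; _∘_)
open import Function.Bundles using (_↔_; module Inverse)
open import Function.Definitions using (Injective; Surjective)
open import Function.Properties.Inverse using (↔⇒↣)
open import Level using (0ℓ)
open import Relation.Binary.Definitions using (DecidableEquality)
open import Relation.Binary.PropositionalEquality
  using (_≡_; _≗_; refl; sym; trans; cong; subst)
open import Relation.Nullary using (¬_; Dec; contradiction)
open import Relation.Nullary.Decidable
  using (via-injection; map′; ¬?; _⊎-dec_; decidable-stable)
open import Relation.Unary
  using (Pred; Decidable; Satisfiable; _∈_; _∉_; _⊆_; _∪_; _∖_; _≐_)

------------------------------------------------------------------------
-- Finite sets, subsets and images

Finite : Set → Set
Finite A = ∃[ n ] (A ↔ Fin n)

finite-≟ : {A : Set} → Finite A → DecidableEquality A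
finite-≟ (_ , e) = via-injection (↔⇒↣ e) Fin._≟_

finite-any? : {A : Set} {P : Pred A 0ℓ} → Finite A → Decidable P → Dec (∃ P)
finite-any? {P = P} (_ , e) P? =
  map′ (λ (k , q) → from k , q)
       (λ (a , q) → to a , subst P (sym (strictlyInverseʳ a)) q)
       (Fin.any? (P? ∘ from))
  where open Inverse e

image : {A B : Set} → (A → B) → Pred A 0ℓ → Pred B 0ℓ
image f X b = ∃[ a ] (a ∈ X × f a ≡ b)

preimage : {A B : Set} → (A → B) → Pred B 0ℓ → Pred A 0ℓ
preimage f Y a = f a ∈ Y

range : {A B : Set} → (A → B) → Pred B 0ℓ
range f b = ∃[ a ] f a ≡ b

-- Direct image of the fibre of g over x.
fibreImage : {A B C : Set} → (A → B) → (A → C) → C → Pred B 0ℓ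
fibreImage f g x = image f (preimage g (_≡ x))

SurjectiveOn : {A B : Set} → Pred A 0ℓ → (A → B) → Set
SurjectiveOn {A} X f = Surjective _≡_ _≡_ (λ (x : Σ[ a ∈ A ] a ∈ X) → f (proj₁ x))

-- The square
--
--     A --g--> C
--     |        |
--     f        j
--     v        v
--     B --i--> D
--
-- is a pushout of finite sets.
record IsSetPushout {A B C D : Set}
  (f : A → B) (g : A → C) (i : B → D) (j : C → D) : Set₁ where
  field
    commutes  : i ∘ f ≗ j ∘ g
    universal : {E : Set} → Finite E →
                (h : B → E) (k : C → E) → h ∘ f ≗ k ∘ g →
                ∃[ u ] (u ∘ i ≗ h × u ∘ j ≗ k ×
                        (∀ (v : D → E) → v ∘ i ≗ h → v ∘ j ≗ k → v ≗ u))

------------------------------------------------------------------------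
-- The data over which all computons are taken

-- The finite set of devices is given by a list enumerating it; only
-- membership in the list is ever used.  The distinguished element ε is
-- not assumed to be the empty word.
record Signature : Set₁ where
  field
    n                : ℕ
    .{{n-nonZero}}   : NonZero n
    Alphabet         : Set
    alphabet-finite  : Finite Alphabet
    B                : List (List Alphabet)
    ε                : List Alphabet
    ε∈B              : ε List.∈ B

module Computons (𝒮 : Signature) where

  open Signature 𝒮

  record Computon : Set₁ where
    field
      U I O P : Set

      U-finite   : Finite U
      I-finite   : Finite I
      O-finite   : Finite O
      P-finite   : Finite P
      P-nonempty : P

      σ : O → U
      τ : I → U
      r : I → O
      t : O → P
      s : I → P
      c : P → Fin n
      f : O → List Alphabet

      f∈B : ∀ o → f o List.∈ B

      σ-surjective : Surjective _≡_ _≡_ σ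
      τ-surjective : Surjective _≡_ _≡_ τ
      r-surjective : Surjective _≡_ _≡_ r

    Control : Pred P 0ℓ
    Control p = toℕ (c p) ≡ 0

    P⁺ : Pred P 0ℓ
    P⁺ p = p ∉ range t

    P⁻ : Pred P 0ℓ
    P⁻ p = p ∉ range s

    field
      τ-control-surjective : SurjectiveOn (preimage s Control) τ
      σ-control-surjective : SurjectiveOn (preimage t Control) σ

      σ∘r≗τ : σ ∘ r ≗ τ

      control-inport  : ∃[ p ] (p ∈ P⁺ × p ∈ Control)
      control-outport : ∃[ q ] (q ∈ P⁻ × q ∈ Control)

    -- consumers p is p•, and producers p is •p.
    consumers producers : P → Pred U 0ℓ
    consumers p = fibreImage τ s p
    producers p = fibreImage σ t p

    P⁺∪P⁻? : Decidable (P⁺ ∪ P⁻)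
    P⁺∪P⁻? p =
      ¬? (finite-any? O-finite (λ o → finite-≟ P-finite (t o) p)) ⊎-dec
      ¬? (finite-any? I-finite (λ i → finite-≟ P-finite (s i) p))

  record Trivial (λ₀ : Computon) : Set where
    open Computon λ₀
    field
      U-empty : ¬ U
      I-empty : ¬ I
      O-empty : ¬ O

  ----------------------------------------------------------------------
  -- The category of computons

  record Hom (λ₁ λ₂ : Computon) : Set where
    private
      module L₁ = Computon λ₁
      module L₂ = Computon λ₂
    field
      onU : L₁.U → L₂.U
      onP : L₁.P → L₂.P
      onI : L₁.I → L₂.I
      onO : L₁.O → L₂.O

      τ-commutes : onU ∘ L₁.τ ≗ L₂.τ ∘ onI
      σ-commutes : onU ∘ L₁.σ ≗ L₂.σ ∘ onO
      s-commutes : onP ∘ L₁.s ≗ L₂.s ∘ onI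
      t-commutes : onP ∘ L₁.t ≗ L₂.t ∘ onO
      r-commutes : onO ∘ L₁.r ≗ L₂.r ∘ onI
      f-commutes : L₂.f ∘ onO ≗ L₁.f
      c-commutes : L₂.c ∘ onP ≗ L₁.c

    i⃗ : Pred L₁.P 0ℓ
    i⃗ p = Satisfiable (L₂.producers (onP p) ∖ image onU (L₁.producers p))

    o⃗ : Pred L₁.P 0ℓ
    o⃗ p = Satisfiable (L₂.consumers (onP p) ∖ image onU (L₁.consumers p))

    field
      boundary : i⃗ ∪ o⃗ ⊆ L₁.P⁺ ∪ L₁.P⁻

  infix 4 _≈_

  record _≈_ {λ₁ λ₂ : Computon} (α β : Hom λ₁ λ₂) : Set where
    private
      module α = Hom α
      module β = Hom β
    field
      ≈U : α.onU ≗ β.onU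
      ≈P : α.onP ≗ β.onP
      ≈I : α.onI ≗ β.onI
      ≈O : α.onO ≗ β.onO

  idHom : {λ₁ : Computon} → Hom λ₁ λ₁
  idHom {λ₁} = record
    { onU = id ; onP = id ; onI = id ; onO = id
    ; τ-commutes = λ _ → refl
    ; σ-commutes = λ _ → refl
    ; s-commutes = λ _ → refl
    ; t-commutes = λ _ → refl
    ; r-commutes = λ _ → refl
    ; f-commutes = λ _ → refl
    ; c-commutes = λ _ → refl
    ; boundary   = λ
        { (inj₁ (u , u∈ , u∉)) → contradiction (u , u∈ , refl) u∉
        ; (inj₂ (u , u∈ , u∉)) → contradiction (u , u∈ , refl) u∉
        }
    }

  infixr 9 _⊙_

  _⊙_ : {λ₁ λ₂ λ₃ : Computon} → Hom λ₂ λ₃ → Hom λ₁ λ₂ → Hom λ₁ λ₃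
  _⊙_ {λ₁} {λ₂} {λ₃} β α = record
    { onU = β.onU ∘ α.onU
    ; onP = β.onP ∘ α.onP
    ; onI = β.onI ∘ α.onI
    ; onO = β.onO ∘ α.onO
    ; τ-commutes = λ i → trans (cong β.onU (α.τ-commutes i)) (β.τ-commutes (α.onI i))
    ; σ-commutes = λ o → trans (cong β.onU (α.σ-commutes o)) (β.σ-commutes (α.onO o))
    ; s-commutes = λ i → trans (cong β.onP (α.s-commutes i)) (β.s-commutes (α.onI i))
    ; t-commutes = λ o → trans (cong β.onP (α.t-commutes o)) (β.t-commutes (α.onO o))
    ; r-commutes = λ i → trans (cong β.onO (α.r-commutes i)) (β.r-commutes (α.onI i))
    ; f-commutes = λ o → trans (β.f-commutes (α.onO o)) (α.f-commutes o)
    ; c-commutes = λ p → trans (β.c-commutes (α.onP p)) (α.c-commutes p)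
    ; boundary   = λ {p} p∈ → decidable-stable (L₁.P⁺∪P⁻? p) (λ p∉ → interior p∉ p∈)
    }
    where
    module α = Hom α
    module β = Hom β
    module L₁ = Computon λ₁
    module L₂ = Computon λ₂
    module L₃ = Computon λ₃

    reflect : ∀ {p} → α.onP p ∈ L₂.P⁺ ∪ L₂.P⁻ → p ∈ L₁.P⁺ ∪ L₁.P⁻
    reflect (inj₁ αp∈) =
      inj₁ λ { (o , refl) → αp∈ (α.onO o , sym (α.t-commutes o)) }
    reflect (inj₂ αp∈) =
      inj₂ λ { (i , refl) → αp∈ (α.onI i , sym (α.s-commutes i)) }

    interior : ∀ {p} → p ∉ L₁.P⁺ ∪ L₁.P⁻ →
      ¬ (Satisfiable (L₃.producers (β.onP (α.onP p)) ∖ image (β.onU ∘ α.onU) (L₁.producers p)) ⊎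
         Satisfiable (L₃.consumers (β.onP (α.onP p)) ∖ image (β.onU ∘ α.onU) (L₁.consumers p)))
    interior p∉ (inj₁ (u , u∈ , u∉)) =
      p∉ (reflect (β.boundary (inj₁ (u , u∈ , λ { (v , v∈ , refl) →
      p∉ (α.boundary (inj₁ (v , v∈ , λ { (w , w∈ , refl) →
      u∉ (w , w∈ , refl) }))) }))))
    interior p∉ (inj₂ (u , u∈ , u∉)) =
      p∉ (reflect (β.boundary (inj₂ (u , u∈ , λ { (v , v∈ , refl) →
      p∉ (α.boundary (inj₂ (v , v∈ , λ { (w , w∈ , refl) →
      u∉ (w , w∈ , refl) }))) }))))

  record Mono {λ₁ λ₂ : Computon} (α : Hom λ₁ λ₂) : Set where
    open Hom α
    field
      onU-injective : Injective _≡_ _≡_ onU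
      onP-injective : Injective _≡_ _≡_ onP
      onI-injective : Injective _≡_ _≡_ onI
      onO-injective : Injective _≡_ _≡_ onO

  infix 4 _≅_

  record _≅_ (λ₁ λ₂ : Computon) : Set where
    field
      to      : Hom λ₁ λ₂
      from    : Hom λ₂ λ₁
      to∘from : to ⊙ from ≈ idHom
      from∘to : from ⊙ to ≈ idHom

  ----------------------------------------------------------------------
  -- Pushouts

  -- The universal property refers to the category of computons; it does
  -- not follow from `componentwise` for arbitrary spans, because of the
  -- boundary condition on morphisms.
  record Pushout {λ₀ λ₁ λ₂ : Computon} (α₁ : Hom λ₀ λ₁) (α₂ : Hom λ₀ λ₂) : Set₁ where
    field
      object : Computon
      ι₁     : Hom λ₁ object
      ι₂     : Hom λ₂ object

    private
      module α₁ = Hom α₁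
      module α₂ = Hom α₂
      module ι₁ = Hom ι₁
      module ι₂ = Hom ι₂

    field
      componentwise-U : IsSetPushout α₁.onU α₂.onU ι₁.onU ι₂.onU
      componentwise-P : IsSetPushout α₁.onP α₂.onP ι₁.onP ι₂.onP
      componentwise-I : IsSetPushout α₁.onI α₂.onI ι₁.onI ι₂.onI
      componentwise-O : IsSetPushout α₁.onO α₂.onO ι₁.onO ι₂.onO

      commutes  : ι₁ ⊙ α₁ ≈ ι₂ ⊙ α₂
      universal : ∀ {κ : Computon} (β₁ : Hom λ₁ κ) (β₂ : Hom λ₂ κ) →
                  β₁ ⊙ α₁ ≈ β₂ ⊙ α₂ →
                  Σ[ u ∈ Hom object κ ]
                    (u ⊙ ι₁ ≈ β₁ × u ⊙ ι₂ ≈ β₂ ×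
                     (∀ (v : Hom object κ) → v ⊙ ι₁ ≈ β₁ → v ⊙ ι₂ ≈ β₂ → v ≈ u))

  ----------------------------------------------------------------------
  -- In-markers and open branching

  record InMarker (λ₀ λ₁ : Computon) : Set where
    field
      hom     : Hom λ₀ λ₁
      trivial : Trivial λ₀
      mono    : Mono hom
      onto-P⁺ : range (Hom.onP hom) ≐ Computon.P⁺ λ₁

  record InMarkerSpan (λ₀ λ₂ λ₃ : Computon) : Set where
    field
      left  : InMarker λ₀ λ₂
      right : InMarker λ₀ λ₃

    leftHom : Hom λ₀ λ₂
    leftHom = InMarker.hom left

    rightHom : Hom λ₀ λ₃
    rightHom = InMarker.hom right

  OpenBranching : {λ₀ λ₂ λ₃ : Computon} → InMarkerSpan λ₀ λ₂ λ₃ → Set₁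
  OpenBranching ρ = Pushout (InMarkerSpan.leftHom ρ) (InMarkerSpan.rightHom ρ)

{-# OPTIONS --safe #-}

-- A computon isomorphic to a trivial one is trivial, so all its ports are
-- inports and an in-marker into it is bijective on ports; hence the left leg
-- of ρ is an isomorphism (not necessarily the given one).  The pushout of an
-- isomorphism is an isomorphism, and pushouts are unique up to isomorphism.

module Submission where

open import Defs
open import Data.Product using (_×_; _,_; proj₁; proj₂)
open import Data.Sum using (inj₁)
open import Function.Base using (id; _∘_)
open import Relation.Binary.PropositionalEquality
  using (_≗_; refl; sym; trans; cong)
open import Relation.Nullary using (contradiction)
open import Relation.Unary using (_∈_)

-- With the identity as right injection, the mediating map can only be `k`. That it also restricts
-- to `h` follows by inserting `f ∘ f⁻¹` and using the cocone equation at `f⁻¹ b`.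
inverse⇒isSetPushout : {A B C : Set} {f : A → B} {f⁻¹ : B → A} (g : A → C) →
  f ∘ f⁻¹ ≗ id → f⁻¹ ∘ f ≗ id → IsSetPushout f g (g ∘ f⁻¹) id
inverse⇒isSetPushout {f⁻¹ = f⁻¹} g f∘f⁻¹ f⁻¹∘f = record
  { commutes  = λ a → cong g (f⁻¹∘f a)
  ; universal = λ _ h k hf≗kg →
      k ,
      (λ b → trans (sym (hf≗kg (f⁻¹ b))) (cong h (f∘f⁻¹ b))) ,
      (λ _ → refl) ,
      λ _ _ v≗k → v≗k
  }

module ComputonProperties (𝒮 : Signature) where

  open Computons 𝒮

  private
    variable
      λ₀ λ₁ λ₂ λ₃ : Computon

  ≈-refl : {α : Hom λ₁ λ₂} → α ≈ α
  ≈-refl = record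
    { ≈U = λ _ → refl ; ≈P = λ _ → refl ; ≈I = λ _ → refl ; ≈O = λ _ → refl }

  ≈-sym : {α β : Hom λ₁ λ₂} → α ≈ β → β ≈ α
  ≈-sym α≈β = record
    { ≈U = sym ∘ ≈U ; ≈P = sym ∘ ≈P ; ≈I = sym ∘ ≈I ; ≈O = sym ∘ ≈O }
    where open _≈_ α≈β

  ≈-trans : {α β γ : Hom λ₁ λ₂} → α ≈ β → β ≈ γ → α ≈ γ
  ≈-trans α≈β β≈γ = record
    { ≈U = λ u → trans (L.≈U u) (R.≈U u)
    ; ≈P = λ p → trans (L.≈P p) (R.≈P p)
    ; ≈I = λ i → trans (L.≈I i) (R.≈I i)
    ; ≈O = λ o → trans (L.≈O o) (R.≈O o)
    }
    where
    module L = _≈_ α≈β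
    module R = _≈_ β≈γ

  -- Since `≈` compares only the four underlying functions, the proof fields of the two composites
  -- need not agree and `refl` suffices; the same holds for the identity laws.
  ⊙-assoc : (γ : Hom λ₂ λ₃) (β : Hom λ₁ λ₂) (α : Hom λ₀ λ₁) →
            (γ ⊙ β) ⊙ α ≈ γ ⊙ (β ⊙ α)
  ⊙-assoc _ _ _ = record
    { ≈U = λ _ → refl ; ≈P = λ _ → refl ; ≈I = λ _ → refl ; ≈O = λ _ → refl }

  ⊙-identityˡ : (α : Hom λ₁ λ₂) → idHom ⊙ α ≈ α
  ⊙-identityˡ _ = record
    { ≈U = λ _ → refl ; ≈P = λ _ → refl ; ≈I = λ _ → refl ; ≈O = λ _ → refl }

  ⊙-identityʳ : (α : Hom λ₁ λ₂) → α ⊙ idHom ≈ α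
  ⊙-identityʳ _ = record
    { ≈U = λ _ → refl ; ≈P = λ _ → refl ; ≈I = λ _ → refl ; ≈O = λ _ → refl }

  ⊙-congˡ : (β : Hom λ₂ λ₃) {α α′ : Hom λ₁ λ₂} → α ≈ α′ → β ⊙ α ≈ β ⊙ α′
  ⊙-congˡ β α≈α′ = record
    { ≈U = λ u → cong β.onU (≈U u)
    ; ≈P = λ p → cong β.onP (≈P p)
    ; ≈I = λ i → cong β.onI (≈I i)
    ; ≈O = λ o → cong β.onO (≈O o)
    }
    where
    module β = Hom β
    open _≈_ α≈α′

  ⊙-congʳ : {β β′ : Hom λ₂ λ₃} (α : Hom λ₁ λ₂) → β ≈ β′ → β ⊙ α ≈ β′ ⊙ α
  ⊙-congʳ α β≈β′ = record
    { ≈U = ≈U ∘ α.onU ; ≈P = ≈P ∘ α.onP ; ≈I = ≈I ∘ α.onI ; ≈O = ≈O ∘ α.onO }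
    where
    module α = Hom α
    open _≈_ β≈β′

  module _ {α₁ : Hom λ₀ λ₁} {α₂ : Hom λ₀ λ₂} where

    mediate : (X Y : Pushout α₁ α₂) → Hom (Pushout.object X) (Pushout.object Y)
    mediate X Y = proj₁ (Pushout.universal X Y.ι₁ Y.ι₂ Y.commutes)
      where module Y = Pushout Y

    -- The round trip and the identity both fix the injections of `X`, so both equal the unique
    -- endomorphism that `X` induces from its own cocone.
    mediate-inverse : (X Y : Pushout α₁ α₂) → mediate Y X ⊙ mediate X Y ≈ idHom
    mediate-inverse X Y =
      ≈-trans (unique (mediate Y X ⊙ mediate X Y) through₁ through₂)
              (≈-sym (unique idHom (⊙-identityˡ X.ι₁) (⊙-identityˡ X.ι₂)))
      where
      module X = Pushout X
      module Y = Pushout Y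

      X→Y = proj₂ (X.universal Y.ι₁ Y.ι₂ Y.commutes)
      Y→X = proj₂ (Y.universal X.ι₁ X.ι₂ X.commutes)

      unique : (v : Hom X.object X.object) → v ⊙ X.ι₁ ≈ X.ι₁ → v ⊙ X.ι₂ ≈ X.ι₂ →
               v ≈ proj₁ (X.universal X.ι₁ X.ι₂ X.commutes)
      unique = proj₂ (proj₂ (proj₂ (X.universal X.ι₁ X.ι₂ X.commutes)))

      through₁ : (mediate Y X ⊙ mediate X Y) ⊙ X.ι₁ ≈ X.ι₁
      through₁ =
        ≈-trans (⊙-assoc (mediate Y X) (mediate X Y) X.ι₁)
        (≈-trans (⊙-congˡ (mediate Y X) (proj₁ X→Y)) (proj₁ Y→X))

      through₂ : (mediate Y X ⊙ mediate X Y) ⊙ X.ι₂ ≈ X.ι₂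
      through₂ =
        ≈-trans (⊙-assoc (mediate Y X) (mediate X Y) X.ι₂)
        (≈-trans (⊙-congˡ (mediate Y X) (proj₁ (proj₂ X→Y))) (proj₁ (proj₂ Y→X)))

    pushout-unique : (X Y : Pushout α₁ α₂) → Pushout.object X ≅ Pushout.object Y
    pushout-unique X Y = record
      { to      = mediate X Y
      ; from    = mediate Y X
      ; to∘from = mediate-inverse Y X
      ; from∘to = mediate-inverse X Y
      }

  iso-pushout : (e : λ₀ ≅ λ₁) (α : Hom λ₀ λ₂) → Pushout (_≅_.to e) α
  iso-pushout {λ₂ = λ₂} e α = record
    { object = λ₂
    ; ι₁     = α ⊙ from
    ; ι₂     = idHom
    -- An isomorphism of computons is a bijection in each component, so all four squares are
    -- instances of the set-level lemma.
    ; componentwise-U = inverse⇒isSetPushout α.onU (≈U to∘from) (≈U from∘to)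
    ; componentwise-P = inverse⇒isSetPushout α.onP (≈P to∘from) (≈P from∘to)
    ; componentwise-I = inverse⇒isSetPushout α.onI (≈I to∘from) (≈I from∘to)
    ; componentwise-O = inverse⇒isSetPushout α.onO (≈O to∘from) (≈O from∘to)
    ; commutes =
        ≈-trans (⊙-assoc α from to)
        (≈-trans (⊙-congˡ α from∘to)
        (≈-trans (⊙-identityʳ α) (≈-sym (⊙-identityˡ α))))
    ; universal = λ β₁ β₂ β₁to≈β₂α →
        -- As `ι₂` is the identity, `β₂` is the forced choice; on the left leg, β₂ α from ≈ β₁ to
        -- from ≈ β₁.
        β₂ ,
        ≈-trans (≈-sym (⊙-assoc β₂ α from))
        (≈-trans (⊙-congʳ from (≈-sym β₁to≈β₂α))
        (≈-trans (⊙-assoc β₁ to from)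
        (≈-trans (⊙-congˡ β₁ to∘from) (⊙-identityʳ β₁)))) ,
        ⊙-identityʳ β₂ ,
        λ v _ v≈β₂ → ≈-trans (≈-sym (⊙-identityʳ v)) v≈β₂
    }
    where
    open _≅_ e
    open _≈_
    module α = Hom α

  -- A set that maps into an empty set is empty.
  trivial-reflect : Hom λ₁ λ₀ → Trivial λ₀ → Trivial λ₁
  trivial-reflect α triv = record
    { U-empty = U-empty ∘ onU ; I-empty = I-empty ∘ onI ; O-empty = O-empty ∘ onO }
    where
    open Hom α
    open Trivial triv

  module _ (m : InMarker λ₀ λ₁) (triv : Trivial λ₁) where

    private
      module L₀ = Computon λ₀
      module L₁ = Computon λ₁
      module T₀ = Trivial (InMarker.trivial m)
      module T₁ = Trivial triv
      open InMarker m using (hom; mono; onto-P⁺)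
      open Hom hom using (onP; c-commutes)

      inport : ∀ p → p ∈ L₁.P⁺
      inport _ (o , _) = T₁.O-empty o

      onP⁻¹ : L₁.P → L₀.P
      onP⁻¹ p = proj₁ (proj₂ onto-P⁺ (inport p))

      onP∘onP⁻¹ : onP ∘ onP⁻¹ ≗ id
      onP∘onP⁻¹ p = proj₂ (proj₂ onto-P⁺ (inport p))

      inverse : Hom λ₁ λ₀
      inverse = record
        { onU = λ u → contradiction u T₁.U-empty
        ; onP = onP⁻¹
        ; onI = λ i → contradiction i T₁.I-empty
        ; onO = λ o → contradiction o T₁.O-empty
        ; τ-commutes = λ i → contradiction i T₁.I-empty
        ; σ-commutes = λ o → contradiction o T₁.O-empty
        ; s-commutes = λ i → contradiction i T₁.I-empty
        ; t-commutes = λ o → contradiction o T₁.O-empty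
        ; r-commutes = λ i → contradiction i T₁.I-empty
        ; f-commutes = λ o → contradiction o T₁.O-empty
        ; c-commutes = λ p →
            trans (sym (c-commutes (onP⁻¹ p))) (cong L₁.c (onP∘onP⁻¹ p))
        -- The boundary condition, which could keep a map from being a morphism, holds automatically
        -- because every port is an inport.
        ; boundary   = λ {p} _ → inj₁ (inport p)
        }

    -- Only ports carry content, as the other components are empty on both sides. Taking `to` to be
    -- the marker itself makes `iso-pushout` applicable to the span as given.
    inMarker-iso : λ₀ ≅ λ₁
    inMarker-iso = record
      { to      = hom
      ; from    = inverse
      ; to∘from = record
          { ≈U = λ u → contradiction u T₁.U-empty
          ; ≈P = onP∘onP⁻¹
          ; ≈I = λ i → contradiction i T₁.I-empty
          ; ≈O = λ o → contradiction o T₁.O-empty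
          }
      ; from∘to = record
          { ≈U = λ u → contradiction u T₀.U-empty
          -- Injectivity turns the right inverse on ports into a two-sided one.
          ; ≈P = λ p → Mono.onP-injective mono (onP∘onP⁻¹ (onP p))
          ; ≈I = λ i → contradiction i T₀.I-empty
          ; ≈O = λ o → contradiction o T₀.O-empty
          }
      }

theorem11 : (𝒮 : Signature) → let open Computons 𝒮 in
    (λ₀ λ₂ λ₃ : Computon) (ρ : InMarkerSpan λ₀ λ₂ λ₃) → λ₀ ≅ λ₂ →
    OpenBranching ρ ×
    ((λ₂?λ₃ : OpenBranching ρ)
    (λ₂+λ₃ : Pushout (InMarkerSpan.leftHom ρ) (InMarkerSpan.rightHom ρ)) →
    Pushout.object λ₂?λ₃ ≅ Pushout.object λ₂+λ₃ ×
    Pushout.object λ₂+λ₃ ≅ λ₃)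
theorem11 𝒮 λ₀ λ₂ λ₃ ρ λ₀≅λ₂ =
  -- `branching` witnesses existence and has `λ₃` as its object by definition, so comparing `Y` with
  -- it yields the second isomorphism.
  branching , λ X Y → pushout-unique X Y , pushout-unique Y branching
  where
  open Computons 𝒮
  open ComputonProperties 𝒮
  open InMarkerSpan ρ

  λ₂-trivial : Trivial λ₂
  λ₂-trivial = trivial-reflect (_≅_.from λ₀≅λ₂) (InMarker.trivial left)

  branching : OpenBranching ρ
  branching = iso-pushout (inMarker-iso left λ₂-trivial) rightHom
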